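{- Let $G$ be a finite, simple, connected graph and $k\ge 0$. If $G$ contains a $k$-supported cycle, then $W(G)\ge k-4$.
   Context: For a vertex $r$ of $G$ (the root) and $x\in V(G)$, let $\ell_r(x)=d_G(r,x)$. For an integer $n\ge 0$, let $R_r(n)$ be the set of edges $xy\in E(G)$ with $\max\{\ell_r(x),\ell_r(y)\}>n$, and write $x\simeq_n y$ if $x$ and $y$ lie in the same connected component of $(V(G),R_r(n))$ (in particular $x\simeq_n x$). Define $W(r)=\max_{n\ge 0}\max\{d_G(x,y): \ell_r(x)=\ell_r(y)=n,\ x\simeq_n y\}$ and $W(G)=\max_{r\in V(G)}W(r)$. A cycle $C$ in $G$ is $k$-supported if it can be partitioned into three edge-disjoint paths $I_1,I_2,I_3$, with $I_1\cap I_2$, $I_2\cap I_3$, $I_3\cap I_1$ each a single vertex, such that for all $u_i\in V(I_i)$ ($i=1,2,3$), $\max_{i,j} d_G(u_i,u_j)\ge k$. -}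

module Defs where

open import Data.Fin.Base using (Fin)
open import Data.Fin.Properties using (any?) renaming (_≟_ to _≟ᶠ_)
open import Data.List.Base using (List; []; _∷_; map; filter; allFin; cartesianProduct)
open import Data.List.Extrema.Nat using (max)
open import Data.List.Membership.Propositional using (_∈_)
open import Data.List.Membership.Propositional.Properties using (∈-allFin)
open import Data.List.Relation.Unary.Any using (here; there)
open import Data.List.Relation.Unary.Unique.Propositional using (Unique)
open import Data.Nat.Base using (ℕ; zero; suc; _≤_; _<_; _⊔_; z≤n; s≤s)
open import Data.Nat.Properties using (suc-injective; _<?_) renaming (_≟_ to _≟ⁿ_)
open import Data.Product using (Σ; ∃; ∃-syntax; _×_; _,_; proj₁; proj₂; uncurry)
open import Data.Sum using (_⊎_; inj₁; inj₂)
open import Function.Base using (_∘_)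
open import Function.Bundles using (_⇔_)
open import Level using (0ℓ)
open import Relation.Binary.Core using (Rel)
open import Relation.Binary.Definitions using (Decidable; Symmetric; Irreflexive)
open import Relation.Binary.Construct.Closure.ReflexiveTransitive using (Star; ε; _◅_; _◅◅_)
open import Relation.Binary.PropositionalEquality using (_≡_; _≢_; refl; cong)
open import Relation.Nullary using (yes; no; ¬_; contradiction)
open import Relation.Nullary.Decidable using (_×-dec_; _⊎-dec_; map′)
import Relation.Unary as U

least : {P : ℕ → Set} → U.Decidable P → ∃ P →
        ∃[ m ] P m × (∀ {j} → P j → m ≤ j)
least {P} P? (b , pb) = go P? b pb
  where
  go : {Q : ℕ → Set} → U.Decidable Q → ∀ b → Q b →
       ∃[ m ] Q m × (∀ {j} → Q j → m ≤ j)
  go Q? zero qb = zero , qb , λ _ → z≤n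
  go {Q} Q? (suc b) qb with Q? zero
  ... | yes q0 = zero , q0 , λ _ → z≤n
  ... | no ¬q0 with go (Q? ∘ suc) b qb
  ...   | m , qm , min = suc m , qm , bound
    where
    bound : ∀ {j} → Q j → suc m ≤ j
    bound {zero}  q = contradiction q ¬q0
    bound {suc j} q = s≤s (min q)

-- Reachability in a finite decidable relation is decidable.  `Via vs x y` says
-- that y is reachable from x through intermediate vertices in vs
-- (Floyd–Warshall).
module _ {n : ℕ} {R : Rel (Fin n) 0ℓ} where

  Via : List (Fin n) → Rel (Fin n) 0ℓ
  Via []       x y = x ≡ y ⊎ R x y
  Via (v ∷ vs) x y = Via vs x y ⊎ (Via vs x v × Via vs v y)

  Via-sound : ∀ vs {x y} → Via vs x y → Star R x y
  Via-sound []       (inj₁ refl)    = ε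
  Via-sound []       (inj₂ r)       = r ◅ ε
  Via-sound (v ∷ vs) (inj₁ p)       = Via-sound vs p
  Via-sound (v ∷ vs) (inj₂ (p , q)) = Via-sound vs p ◅◅ Via-sound vs q

  Via-base : ∀ vs {x y} → x ≡ y ⊎ R x y → Via vs x y
  Via-base []       p = p
  Via-base (v ∷ vs) p = inj₁ (Via-base vs p)

  Via-trans : ∀ {vs x y v} → v ∈ vs → Via vs x v → Via vs v y → Via vs x y
  Via-trans (here refl) (inj₁ p)       (inj₁ q)       = inj₂ (p , q)
  Via-trans (here refl) (inj₁ p)       (inj₂ (_ , q)) = inj₂ (p , q)
  Via-trans (here refl) (inj₂ (p , _)) (inj₁ q)       = inj₂ (p , q)
  Via-trans (here refl) (inj₂ (p , _)) (inj₂ (_ , q)) = inj₂ (p , q)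
  Via-trans (there i) (inj₁ p)        (inj₁ q)        = inj₁ (Via-trans i p q)
  Via-trans (there i) (inj₁ p)        (inj₂ (q , q′)) = inj₂ (Via-trans i p q , q′)
  Via-trans (there i) (inj₂ (p , p′)) (inj₁ q)        = inj₂ (p , Via-trans i p′ q)
  Via-trans (there i) (inj₂ (p , _))  (inj₂ (_ , q))  = inj₂ (p , q)

  Via-complete : ∀ {x y} → Star R x y → Via (allFin n) x y
  Via-complete ε       = Via-base (allFin n) (inj₁ refl)
  Via-complete (r ◅ p) =
    Via-trans (∈-allFin _) (Via-base (allFin n) (inj₂ r)) (Via-complete p)

  module _ (R? : Decidable R) where

    Via? : ∀ vs → Decidable (Via vs)
    Via? []       x y = (x ≟ᶠ y) ⊎-dec R? x y
    Via? (v ∷ vs) x y = Via? vs x y ⊎-dec (Via? vs x v ×-dec Via? vs v y)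

    Star? : Decidable (Star R)
    Star? x y = map′ (Via-sound (allFin n)) Via-complete (Via? (allFin n) x y)

record Graph (n : ℕ) : Set₁ where
  field
    Adj    : Rel (Fin n) 0ℓ
    Adj?   : Decidable Adj
    symm   : Symmetric Adj
    irrefl : Irreflexive _≡_ Adj

  Vertex : Set
  Vertex = Fin n

  Walk : Rel Vertex 0ℓ
  Walk = Star Adj

  length : ∀ {x y} → Walk x y → ℕ
  length ε       = zero
  length (_ ◅ p) = suc (length p)

  vertices : ∀ {x y} → Walk x y → List Vertex
  vertices {x} ε       = x ∷ []
  vertices {x} (_ ◅ p) = x ∷ vertices p

  -- The vertices without the final one, so that a closed walk does not list
  -- its base vertex twice.
  initVertices : ∀ {x y} → Walk x y → List Vertex
  initVertices     ε       = []
  initVertices {x} (_ ◅ p) = x ∷ initVertices p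

  -- The unordered edge {a , b} occurs in the walk.
  data HasEdge (a b : Vertex) : ∀ {x y} → Walk x y → Set where
    forward  : ∀ {y} {e : Adj a b} {p : Walk b y} → HasEdge a b (e ◅ p)
    backward : ∀ {y} {e : Adj b a} {p : Walk a y} → HasEdge a b (e ◅ p)
    later    : ∀ {x y z} {e : Adj x z} {p : Walk z y} →
               HasEdge a b p → HasEdge a b (e ◅ p)

  record Path : Set where
    field
      {source target} : Vertex
      walk            : Walk source target
      distinct        : Unique (vertices walk)

  record Cycle : Set where
    field
      {base}   : Vertex
      walk     : Walk base base
      length≥3 : 3 ≤ length walk
      distinct : Unique (initVertices walk)

  _∈ᴾ_ : Vertex → Path → Set
  v ∈ᴾ I = v ∈ vertices (Path.walk I)

  _∈ᶜ_ : Vertex → Cycle → Set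
  v ∈ᶜ C = v ∈ vertices (Cycle.walk C)

  Connected : Set
  Connected = ∀ x y → Walk x y

  HasWalk : Vertex → Vertex → ℕ → Set
  HasWalk x y m = Σ (Walk x y) λ p → length p ≡ m

  HasWalk? : ∀ x y → U.Decidable (HasWalk x y)
  HasWalk? x y zero = map′ to from (x ≟ᶠ y)
    where
    to : x ≡ y → HasWalk x y zero
    to refl = ε , refl
    from : HasWalk x y zero → x ≡ y
    from (ε , _) = refl
  HasWalk? x y (suc m) = map′ to from (any? λ z → Adj? x z ×-dec HasWalk? z y m)
    where
    to : (∃ λ z → Adj x z × HasWalk z y m) → HasWalk x y (suc m)
    to (_ , e , p , eq) = e ◅ p , cong suc eq
    from : HasWalk x y (suc m) → ∃ λ z → Adj x z × HasWalk z y m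
    from (e ◅ p , eq) = _ , e , p , suc-injective eq

module Metric {n : ℕ} (G : Graph n) (connected : Graph.Connected G) where
  open Graph G

  shortest : ∀ x y → ∃[ m ] HasWalk x y m × (∀ {j} → HasWalk x y j → m ≤ j)
  shortest x y = least (HasWalk? x y) (length (connected x y) , connected x y , refl)

  dist : Vertex → Vertex → ℕ
  dist x y = proj₁ (shortest x y)

  ℓ : Vertex → Vertex → ℕ
  ℓ r x = dist r x

  -- R r m x y : the pair xy is an edge in R_r(m).
  R : Vertex → ℕ → Rel Vertex 0ℓ
  R r m x y = Adj x y × m < ℓ r x ⊔ ℓ r y

  R? : ∀ r m → Decidable (R r m)
  R? r m x y = Adj? x y ×-dec (m <? ℓ r x ⊔ ℓ r y)

  -- R r m is symmetric, so its reflexive transitive closure relates exactly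
  -- the vertices in a common connected component of (V , R_r(m)).
  _≃[_,_]_ : Vertex → Vertex → ℕ → Vertex → Set
  x ≃[ r , m ] y = Star (R r m) x y

  Admissible : Vertex → Vertex × Vertex → Set
  Admissible r (x , y) = ∃[ m ] ℓ r x ≡ m × ℓ r y ≡ m × x ≃[ r , m ] y

  Admissible? : ∀ r → U.Decidable (Admissible r)
  Admissible? r (x , y) = map′ to from
    ((ℓ r y ≟ⁿ ℓ r x) ×-dec Star? (R? r (ℓ r x)) x y)
    where
    to : ℓ r y ≡ ℓ r x × x ≃[ r , ℓ r x ] y → Admissible r (x , y)
    to (eq , c) = ℓ r x , refl , eq , c
    from : Admissible r (x , y) → ℓ r y ≡ ℓ r x × x ≃[ r , ℓ r x ] y
    from (_ , refl , eq , c) = eq , c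

  -- W(r).  The two nested maxima (over levels, then over pairs on a level) are
  -- one maximum over all admissible pairs; (r , r) is always admissible, so
  -- the default value 0 does not affect the result.
  Wᵣ : Vertex → ℕ
  Wᵣ r = max 0 (map (uncurry dist)
                    (filter (Admissible? r) (cartesianProduct (allFin n) (allFin n))))

  W : ℕ
  W = max 0 (map Wᵣ (allFin n))

  record Supported (k : ℕ) (C : Cycle) : Set where
    field
      I             : Fin 3 → Path
      vertex-cover  : ∀ v → v ∈ᶜ C ⇔ (∃[ i ] v ∈ᴾ I i)
      edge-cover    : ∀ a b → HasEdge a b (Cycle.walk C) ⇔
                              (∃[ i ] HasEdge a b (Path.walk (I i)))
      edge-disjoint : ∀ {i j} → i ≢ j → ∀ {a b} →
                      HasEdge a b (Path.walk (I i)) → ¬ HasEdge a b (Path.walk (I j))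
      single-meet   : ∀ {i j} → i ≢ j →
                      ∃[ v ] (∀ u → (u ∈ᴾ I i × u ∈ᴾ I j) ⇔ u ≡ v)
      far           : ∀ {u₁ u₂ u₃} → u₁ ∈ᴾ I Fin.zero → u₂ ∈ᴾ I (Fin.suc Fin.zero) →
                      u₃ ∈ᴾ I (Fin.suc (Fin.suc Fin.zero)) →
                      k ≤ dist u₁ u₂ ⊔ dist u₂ u₃ ⊔ dist u₃ u₁

{-# OPTIONS --safe #-}

-- Root G at a vertex r of I₁ ∩ I₂ and let u be a vertex of I₃ of least level.
-- If u = r, all three paths pass through r.  Otherwise ℓ(u) = p + 1, and I₃ has
-- only levels above p, so it lies in a single ≃_p-class.  I₁ and I₂ lead from r
-- to I₃, hence they have vertices x and y of level p from which one reaches I₃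
-- through R_r(p); a neighbour u′ of u of level p is in the same class as well.
-- So x, y, u′ are pairwise at distance at most W(r), and x, y, u pairwise at
-- distance at most W(r) + 1.
module Submission where

open import Data.List.Extrema.Nat using (argmin; argmin-all; f[argmin]≤f[xs]; xs≤max)
open import Data.List.Membership.Propositional using (_∈_)
open import Data.List.Membership.Propositional.Properties using (∈-allFin; ∈-map⁺; ∈-filter⁺; ∈-cartesianProduct⁺)
open import Data.List.Relation.Unary.All as All using ()
open import Data.List.Relation.Unary.Any using (here; there)
open import Data.Fin.Base using (zero; suc)
open import Data.Nat.Base using (ℕ; zero; suc; _+_; _≤_; _<_; _≥_; z≤n; s≤s; s≤s⁻¹)
open import Data.Nat.Properties
open import Data.Product using (∃-syntax; _×_; _,_; proj₁; proj₂; uncurry)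
open import Data.Sum using (_⊎_; inj₁; inj₂)
open import Function.Base using (id; _∘_)
open import Function.Bundles using (Equivalence)
open import Level using (0ℓ)
open import Relation.Binary.Construct.Closure.ReflexiveTransitive as Star using (Star; ε; _◅_; _◅◅_)
open import Relation.Binary.Core using (Rel)
open import Relation.Binary.Definitions using (Symmetric)
open import Relation.Binary.PropositionalEquality using (_≡_; refl; sym; cong; subst)
open import Relation.Nullary using (yes; no)
open import Defs

module _ {n : ℕ} (G : Graph n) where
  open Graph G

  -- Requiring `P` at both ends keeps the relation symmetric, so its chains can be reversed.
  Within : (Vertex → Set) → Rel Vertex 0ℓ
  Within P x y = Adj x y × P x × P y

  Within-sym : ∀ P → Symmetric (Within P)
  Within-sym P (e , px , py) = symm e , py , px

  source∈vertices : ∀ {s t} (w : Walk s t) → s ∈ vertices w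
  source∈vertices ε       = here refl
  source∈vertices (_ ◅ _) = here refl

  source-reaches : ∀ {P : Vertex → Set} {s t u} (w : Walk s t) →
                   (∀ {v} → v ∈ vertices w → P v) → u ∈ vertices w →
                   Star (Within P) s u
  source-reaches ε       P-on (here refl) = ε
  source-reaches (_ ◅ _) P-on (here refl) = ε
  source-reaches (e ◅ w) P-on (there u∈w) =
    (e , P-on (here refl) , P-on (there (source∈vertices w)))
      ◅ source-reaches w (P-on ∘ there) u∈w

  -- Going back from `u` to the source and then forward to `v` avoids asking which of the two comes
  -- first on `w`.
  vertices-joined : ∀ {P : Vertex → Set} {s t u v} (w : Walk s t) →
                    (∀ {x} → x ∈ vertices w → P x) →
                    u ∈ vertices w → v ∈ vertices w → Star (Within P) u v
  vertices-joined {P} w P-on u∈w v∈w =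
    Star.reverse (Within-sym P) (source-reaches w P-on u∈w)
      ◅◅ source-reaches w P-on v∈w

  snoc-walk : ∀ {x y z m} → HasWalk x y m → Adj y z → HasWalk x z (suc m)
  snoc-walk (ε , refl)      e = e ◅ ε , refl
  snoc-walk (e′ ◅ w , refl) e with snoc-walk (w , refl) e
  ... | w′ , eq = e′ ◅ w′ , cong suc eq

  unsnoc-walk : ∀ {x z m} → HasWalk x z (suc m) → ∃[ y ] HasWalk x y m × Adj y z
  unsnoc-walk (e ◅ ε , refl) = _ , (ε , refl) , e
  unsnoc-walk (e ◅ e′ ◅ w , refl) with unsnoc-walk (e′ ◅ w , refl)
  ... | y , (w′ , eq) , e″ = y , (e ◅ w′ , cong suc eq) , e″

  module _ (connected : Connected) where
    open Metric G connected

    geodesic : ∀ x y → HasWalk x y (dist x y)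
    geodesic x y = proj₁ (proj₂ (shortest x y))

    dist-minimal : ∀ {x y m} → HasWalk x y m → dist x y ≤ m
    dist-minimal {x} {y} = proj₂ (proj₂ (shortest x y))

    dist-refl : ∀ x → dist x x ≡ 0
    dist-refl x = n≤0⇒n≡0 (dist-minimal (ε , refl))

    dist≡0⇒≡ : ∀ {x y} → dist x y ≡ 0 → x ≡ y
    dist≡0⇒≡ {x} {y} eq with subst (HasWalk x y) eq (geodesic x y)
    ... | ε , _ = refl

    dist-adjʳ : ∀ {x y z} → Adj y z → dist x z ≤ suc (dist x y)
    dist-adjʳ e = dist-minimal (snoc-walk (geodesic _ _) e)

    dist-adjˡ : ∀ {x y z} → Adj x y → dist x z ≤ suc (dist y z)
    dist-adjˡ {y = y} {z} e with geodesic y z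
    ... | w , eq = dist-minimal (e ◅ w , cong suc eq)

    -- The last vertex but one of a geodesic: its level is at most `p` by the shortened walk, and at
    -- least `p` because an edge changes levels by at most one.
    predecessor : ∀ {r u p} → ℓ r u ≡ suc p → ∃[ v ] Adj v u × ℓ r v ≡ p
    predecessor {r} {u} {p} eq with unsnoc-walk (subst (HasWalk r u) eq (geodesic r u))
    ... | v , w , e = v , e ,
      ≤-antisym (dist-minimal w)
                (s≤s⁻¹ (subst (_≤ suc (ℓ r v)) eq (dist-adjʳ e)))

    R-sym : ∀ r p → Symmetric (R r p)
    R-sym r p {x} {y} (e , p<) = symm e , subst (p <_) (⊔-comm (ℓ r x) (ℓ r y)) p<

    admissible⇒dist≤W : ∀ {r x y} → Admissible r (x , y) → dist x y ≤ W
    admissible⇒dist≤W {r} {x} {y} adm = ≤-trans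
      (All.lookup (xs≤max 0 _)
        (∈-map⁺ (uncurry dist)
          (∈-filter⁺ (Admissible? r)
            (∈-cartesianProduct⁺ (∈-allFin x) (∈-allFin y)) adm)))
      (All.lookup (xs≤max 0 _) (∈-map⁺ Wᵣ (∈-allFin r)))

    -- Every edge of such a walk has its ends above level `p`, so it belongs to `R r p`.
    above-≃ : ∀ {r p s t u v} (w : Walk s t) →
              (∀ {x} → x ∈ vertices w → p < ℓ r x) →
              u ∈ vertices w → v ∈ vertices w → u ≃[ r , p ] v
    above-≃ {r} {p} w above u∈w v∈w =
      Star.map (λ {x} {y} (e , p<x , _) → e , ≤-trans p<x (m≤m⊔n (ℓ r x) (ℓ r y)))
               (vertices-joined w above u∈w v∈w)

    LastAt : (Vertex → Set) → Vertex → ℕ → Vertex → Set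
    LastAt P r p v = ∃[ x ] P x × ℓ r x ≡ p × x ≃[ r , p ] v

    -- The last vertex of level at most p on the way to v has level exactly p.
    last-crossing : ∀ {P : Vertex → Set} {r p s v} → Star (Within P) s v → p < ℓ r v →
                    (p < ℓ r s × s ≃[ r , p ] v) ⊎ LastAt P r p v
    last-crossing ε p<v = inj₁ (p<v , ε)
    last-crossing {r = r} {p} {s} (_◅_ {j = z} (e , Ps , _) w) p<v
      with last-crossing w p<v
    ... | inj₂ found = inj₂ found
    -- Since `z` is above level `p`, the edge from `s` to `z` is in `R r p` whatever the level of
    -- `s`.
    ... | inj₁ (p<z , z≃v) with (e , ≤-trans p<z (m≤n⊔m (ℓ r s) (ℓ r z))) ◅ z≃v | p <? ℓ r s
    ...   | s≃v | yes p<s = inj₁ (p<s , s≃v)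
    -- Here the edge climbs from level at most `p` to above `p`, which forces `s` to have level
    -- exactly `p`.
    ...   | s≃v | no  p≮s = inj₂ (s , Ps ,
              ≤-antisym (≮⇒≥ p≮s) (s≤s⁻¹ (≤-trans p<z (dist-adjʳ e))) , s≃v)

    path-crossing : ∀ {r p v} (I : Path) → r ∈ᴾ I → v ∈ᴾ I → p < ℓ r v →
                    LastAt (_∈ᴾ I) r p v
    path-crossing {r} I r∈I v∈I p<v
      with last-crossing (vertices-joined (Path.walk I) id r∈I v∈I) p<v
    ... | inj₂ found     = found
    -- The root has level 0, so it cannot lie above level `p`.
    ... | inj₁ (p<r , _) with subst (_ <_) (dist-refl r) p<r
    ...   | ()

    lowest : ∀ r (I : Path) → ∃[ u ] u ∈ᴾ I × (∀ {v} → v ∈ᴾ I → ℓ r u ≤ ℓ r v)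
    lowest r I =
      -- The default value `s` is itself on the path, so the minimiser is too.
      argmin (ℓ r) s vs ,
      argmin-all (ℓ r) (source∈vertices (Path.walk I)) (All.tabulate id) ,
      All.lookup (f[argmin]≤f[xs] {f = ℓ r} s vs)
      where
      s  = Path.source I
      vs = vertices (Path.walk I)

    close-triple : ∀ {a b c} (I₁ I₂ I₃ : Path) →
                   a ∈ᴾ I₁ → a ∈ᴾ I₂ → b ∈ᴾ I₂ → b ∈ᴾ I₃ → c ∈ᴾ I₃ → c ∈ᴾ I₁ →
                   ∃[ x ] ∃[ y ] ∃[ u ] x ∈ᴾ I₁ × y ∈ᴾ I₂ × u ∈ᴾ I₃ ×
                     dist x y ≤ suc W × dist y u ≤ suc W × dist u x ≤ suc W
    close-triple {a} {b} {c} I₁ I₂ I₃ a∈₁ a∈₂ b∈₂ b∈₃ c∈₃ c∈₁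
      with lowest a I₃
    ... | u , u∈₃ , u-min with ℓ a u in ℓu
    ...   | zero with dist≡0⇒≡ ℓu
    ...     | refl = a , a , a , a∈₁ , a∈₂ , u∈₃ , aa , aa , aa
      where
      aa : dist a a ≤ suc W
      aa = subst (_≤ suc W) (sym (dist-refl a)) z≤n
    close-triple {a} {b} {c} I₁ I₂ I₃ a∈₁ a∈₂ b∈₂ b∈₃ c∈₃ c∈₁
        | u , u∈₃ , u-min | suc p
      -- Both `c` and `b` lie on `I₃`, so minimality of `u` puts them at level at least `suc p`.
      with path-crossing I₁ a∈₁ c∈₁ (u-min c∈₃)
         | path-crossing I₂ a∈₂ b∈₂ (u-min b∈₃)
         | predecessor ℓu
    ...   | x , x∈₁ , ℓx , x≃c | y , y∈₂ , ℓy , y≃b | u′ , e , ℓu′ =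
      x , y , u , x∈₁ , y∈₂ , u∈₃ ,
      -- The vertices `x`, `y` and `u′` share level `p`; only replacing `u′` by its neighbour `u`
      -- costs the extra 1.
      m≤n⇒m≤1+n (near ℓx ℓy x≃u y≃u) ,
      ≤-trans (dist-adjʳ e) (s≤s (near ℓy ℓu′ y≃u u′≃u)) ,
      ≤-trans (dist-adjˡ (symm e)) (s≤s (near ℓu′ ℓx u′≃u x≃u))
      where
      near : ∀ {v w} → ℓ a v ≡ p → ℓ a w ≡ p → v ≃[ a , p ] u → w ≃[ a , p ] u →
             dist v w ≤ W
      near ℓv ℓw v≃u w≃u =
        admissible⇒dist≤W (p , ℓv , ℓw , v≃u ◅◅ Star.reverse (R-sym a p) w≃u)
      x≃u : x ≃[ a , p ] u
      x≃u = x≃c ◅◅ above-≃ (Path.walk I₃) u-min c∈₃ u∈₃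
      y≃u : y ≃[ a , p ] u
      y≃u = y≃b ◅◅ above-≃ (Path.walk I₃) u-min b∈₃ u∈₃
      u′≃u : u′ ≃[ a , p ] u
      u′≃u = (e , ≤-trans (≤-reflexive (sym ℓu)) (m≤n⊔m (ℓ a u′) (ℓ a u))) ◅ ε

    open Supported using (I; single-meet; far)

    -- The meeting vertices of the three paths feed `close-triple`, whose triple is then tested
    -- against `far`.
    supported⇒≤1+W : ∀ {k C} → Supported k C → k ≤ suc W
    supported⇒≤1+W S
      with single-meet S {zero} {suc zero} (λ ())
         | single-meet S {suc zero} {suc (suc zero)} (λ ())
         | single-meet S {suc (suc zero)} {zero} (λ ())
    ... | a , meet-a | b , meet-b | c , meet-c
      with Equivalence.from (meet-a a) refl
         | Equivalence.from (meet-b b) refl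
         | Equivalence.from (meet-c c) refl
    ... | a∈₁ , a∈₂ | b∈₂ , b∈₃ | c∈₃ , c∈₁
      with close-triple (I S zero) (I S (suc zero)) (I S (suc (suc zero))) a∈₁ a∈₂ b∈₂ b∈₃ c∈₃ c∈₁
    ... | x , y , u , x∈₁ , y∈₂ , u∈₃ , xy , yu , ux =
      ≤-trans (far S x∈₁ y∈₂ u∈₃) (⊔-lub (⊔-lub xy yu) ux)

mainTheorem4 : ∀ {n : ℕ} (G : Graph n) (connected : Graph.Connected G) (k : ℕ) →
    (∃[ C ] Metric.Supported G connected k C) →
    Metric.W G connected + 4 ≥ k
mainTheorem4 G connected k (C , S) = begin
  k                            ≤⟨ supported⇒≤1+W G connected S ⟩
  suc (Metric.W G connected)   ≡⟨ +-comm 1 (Metric.W G connected) ⟩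
  -- The argument loses only 1, so the constant 4 leaves slack.
  Metric.W G connected + 1     ≤⟨ +-monoʳ-≤ (Metric.W G connected) (s≤s z≤n) ⟩
  Metric.W G connected + 4     ∎
  where open ≤-Reasoning
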